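{- Let $G$ be a finite, simple, undirected, connected graph with $n$ vertices. Then $\gamma_3(G)+\kappa(G)=2n-2$ if and only if $G$ is isomorphic to $K_4$, $C_4$ or $K_{1,2}$.
   Context: In a graph $G=(V,E)$, a vertex dominates itself and its neighbours. A set $S\subseteq V$ is a three dominating set of $G$ if every vertex in $V\setminus S$ is dominated by at least three vertices of $S$ (equivalently, every vertex of $V\setminus S$ has at least three neighbours in $S$). The three domination number $\gamma_3(G)$ is the minimum cardinality of a three dominating set of $G$. The connectivity $\kappa(G)$ of a connected graph $G$ is the minimum number of vertices whose removal results in a disconnected or trivial (one-vertex) graph; in particular $\kappa(K_n)=n-1$. $C_n$ denotes the cycle on $n$ vertices and $K_{m,n}$ the complete bipartite graph with parts of sizes $m$ and $n$. -}

module Defs where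

open import Data.Fin.Base using (Fin; zero; suc; toℕ)
open import Data.Fin.Properties using (all?) renaming (_≟_ to _≟ᶠ_)
open import Data.Fin.Subset using (Subset; inside; outside; ⊤; ∁; _∩_; _∉_; ∣_∣)
open import Data.Fin.Subset.Properties using (_∈?_; ∈⊤; ∣⊤∣≡n; ∣∁p∣≡n∸∣p∣; anySubset?)
open import Data.List.Base using (List; []; _∷_; allFin)
open import Data.List.Membership.Propositional using () renaming (_∈_ to _∈ˡ_)
open import Data.List.Membership.Propositional.Properties using (∈-allFin)
open import Data.List.Relation.Unary.Any using (here; there)
open import Data.Nat.Base using (ℕ; suc; _+_; _∸_; _≤_; _<_; s≤s; NonZero)
open import Data.Nat.Induction using (<-wellFounded)
open import Data.Nat.Properties using (_≟_; _≤?_; _<?_; ≮⇒≥; <⇒≱; 1+n≢n; n∸n≡0)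
open import Data.Product.Base using (∃; ∃-syntax; _×_; _,_; proj₁)
open import Data.Sum.Base using (_⊎_; inj₁; inj₂) renaming (swap to ⊎-swap)
open import Data.Vec.Base using (tabulate; _∷_)
open import Function.Base using (case_of_)
open import Function.Bundles using (_⇔_; _↔_; Inverse)
open import Induction.WellFounded using (Acc; acc)
open import Level using (0ℓ)
open import Relation.Binary.Core using (Rel)
open import Relation.Binary.Definitions using (Irreflexive; Symmetric) renaming (Decidable to Decidable₂)
open import Relation.Binary.Construct.Closure.ReflexiveTransitive using (Star; ε; _◅_; _◅◅_)
open import Relation.Binary.PropositionalEquality using (_≡_; _≢_; refl; sym; trans; cong; ≢-sym)
open import Relation.Nullary using (¬_; Dec; does; yes; no; contradiction)
open import Relation.Nullary.Decidable using (map′; ¬?; _×-dec_; _⊎-dec_; _→-dec_)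
open import Relation.Unary using (Pred; Decidable)

record Graph (n : ℕ) : Set₁ where
  field
    Adj    : Rel (Fin n) 0ℓ
    irrefl : Irreflexive _≡_ Adj
    symm   : Symmetric Adj
    adj?   : Decidable₂ Adj

open Graph public

record _≅_ {m n : ℕ} (G : Graph m) (H : Graph n) : Set where
  field
    bijection : Fin m ↔ Fin n
    adjacency : ∀ u v → Adj G u v ⇔ Adj H (Inverse.to bijection u) (Inverse.to bijection v)

infix 4 _≅_

K : ∀ n → Graph n
K n = record
  { Adj    = _≢_
  ; irrefl = λ u≡v u≢v → u≢v u≡v
  ; symm   = ≢-sym
  ; adj?   = λ u v → ¬? (u ≟ᶠ v)
  }

-- Successor along the cyclic order 0, 1, …, n ∸ 1, 0.
Next : ∀ {n} → Rel (Fin n) 0ℓ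
Next {n} i j = toℕ j ≡ suc (toℕ i) ⊎ (suc (toℕ i) ≡ n × toℕ j ≡ 0)

next? : ∀ {n} → Decidable₂ (Next {n})
next? {n} i j = (toℕ j ≟ suc (toℕ i)) ⊎-dec ((suc (toℕ i) ≟ n) ×-dec (toℕ j ≟ 0))

next-irrefl : ∀ {n} → 3 ≤ n → (i : Fin n) → ¬ Next i i
next-irrefl 3≤n i (inj₁ eq) = 1+n≢n (sym eq)
next-irrefl 3≤n i (inj₂ (last , first)) with trans (sym last) (cong suc first)
... | refl = case 3≤n of λ { (s≤s ()) }

C : ∀ n → 3 ≤ n → Graph n
C n 3≤n = record
  { Adj    = λ i j → Next i j ⊎ Next j i
  ; irrefl = λ { {i} refl (inj₁ p) → next-irrefl 3≤n i p
               ; {i} refl (inj₂ p) → next-irrefl 3≤n i p }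
  ; symm   = ⊎-swap
  ; adj?   = λ i j → next? i j ⊎-dec next? j i
  }

-- The parts are {0, …, m ∸ 1} and {m, …, m + n ∸ 1}.
K[_,_] : ∀ m n → Graph (m + n)
K[ m , n ] = record
  { Adj    = λ i j → Across i j ⊎ Across j i
  ; irrefl = λ { refl (inj₁ (i<m , m≤i)) → <⇒≱ i<m m≤i
               ; refl (inj₂ (i<m , m≤i)) → <⇒≱ i<m m≤i }
  ; symm   = ⊎-swap
  ; adj?   = λ i j → across? i j ⊎-dec across? j i
  }
  where
  Across : Rel (Fin (m + n)) 0ℓ
  Across i j = toℕ i < m × m ≤ toℕ j

  across? : Decidable₂ Across
  across? i j = (toℕ i <? m) ×-dec (m ≤? toℕ j)

-- Star (Adj G) u v is the type of walks from u to v.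
Connected : ∀ {n} → Graph n → Set
Connected G = ∀ u v → Star (Adj G) u v

-- In particular the graph with no vertices is not disconnected.
Disconnected : ∀ {n} → Graph n → Set
Disconnected G = ¬ Connected G

Trivial : ∀ {n} → Graph n → Set
Trivial {n} _ = n ≡ 1

-- Reachability is decided by the Floyd–Warshall recursion: Via G ws u v
-- says that v can be reached from u with all intermediate vertices in ws.
module _ {n} (G : Graph n) where

  Via : List (Fin n) → Rel (Fin n) 0ℓ
  Via []       u v = u ≡ v ⊎ Adj G u v
  Via (w ∷ ws) u v = Via ws u v ⊎ (Via ws u w × Via ws w v)

  via? : ∀ ws → Decidable₂ (Via ws)
  via? []       u v = (u ≟ᶠ v) ⊎-dec adj? G u v
  via? (w ∷ ws) u v = via? ws u v ⊎-dec (via? ws u w ×-dec via? ws w v)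

  via⇒walk : ∀ ws {u v} → Via ws u v → Star (Adj G) u v
  via⇒walk []       (inj₁ refl)    = ε
  via⇒walk []       (inj₂ e)       = e ◅ ε
  via⇒walk (w ∷ ws) (inj₁ p)       = via⇒walk ws p
  via⇒walk (w ∷ ws) (inj₂ (p , q)) = via⇒walk ws p ◅◅ via⇒walk ws q

  via-trans : ∀ ws {u w v} → w ∈ˡ ws → Via ws u w → Via ws w v → Via ws u v
  via-trans (x ∷ ws) (here refl) p q = inj₂ (into p , from q)
    where
    into : ∀ {u} → Via (x ∷ ws) u x → Via ws u x
    into (inj₁ p)       = p
    into (inj₂ (p , _)) = p
    from : ∀ {v} → Via (x ∷ ws) x v → Via ws x v
    from (inj₁ q)       = q
    from (inj₂ (_ , q)) = q
  via-trans (x ∷ ws) (there w∈) (inj₁ p)       (inj₁ q)       = inj₁ (via-trans ws w∈ p q)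
  via-trans (x ∷ ws) (there w∈) (inj₁ p)       (inj₂ (q , r)) = inj₂ (via-trans ws w∈ p q , r)
  via-trans (x ∷ ws) (there w∈) (inj₂ (p , q)) (inj₁ r)       = inj₂ (p , via-trans ws w∈ q r)
  via-trans (x ∷ ws) (there w∈) (inj₂ (p , _)) (inj₂ (_ , r)) = inj₂ (p , r)

  via-weaken : ∀ ws {u v} → Via [] u v → Via ws u v
  via-weaken []       p = p
  via-weaken (w ∷ ws) p = inj₁ (via-weaken ws p)

  walk⇒via : ∀ {u v} → Star (Adj G) u v → Via (allFin n) u v
  walk⇒via ε       = via-weaken (allFin n) (inj₁ refl)
  walk⇒via (e ◅ p) =
    via-trans (allFin n) (∈-allFin _) (via-weaken (allFin n) (inj₂ e)) (walk⇒via p)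

  walk? : Decidable₂ (Star (Adj G))
  walk? u v = map′ (via⇒walk (allFin n)) walk⇒via (via? (allFin n) u v)

  connected? : Dec (Connected G)
  connected? = all? λ u → all? λ v → walk? u v

-- The increasing enumeration of the members of U.
enum : ∀ {n} (U : Subset n) → Fin ∣ U ∣ → Fin n
enum (inside  ∷ U) zero    = zero
enum (inside  ∷ U) (suc i) = suc (enum U i)
enum (outside ∷ U) i       = suc (enum U i)

induced : ∀ {n} → Graph n → (U : Subset n) → Graph ∣ U ∣
induced G U = record
  { Adj    = λ i j → Adj G (enum U i) (enum U j)
  ; irrefl = λ i≡j → irrefl G (cong (enum U) i≡j)
  ; symm   = symm G
  ; adj?   = λ i j → adj? G (enum U i) (enum U j)
  }

_─_ : ∀ {n} → Graph n → (X : Subset n) → Graph ∣ ∁ X ∣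
G ─ X = induced G (∁ X)

IsMinCard : ∀ {n} → Pred (Subset n) 0ℓ → ℕ → Set
IsMinCard P k = (∃[ S ] P S × ∣ S ∣ ≡ k) × (∀ S → P S → k ≤ ∣ S ∣)

minCard : ∀ {n} {P : Pred (Subset n) 0ℓ} → Decidable P → ∃ P → ∃ (IsMinCard P)
minCard {n} {P} P? (S₀ , PS₀) = descend S₀ PS₀ (<-wellFounded ∣ S₀ ∣)
  where
  descend : ∀ S → P S → Acc _<_ ∣ S ∣ → ∃ (IsMinCard P)
  descend S PS (acc rec) with anySubset? (λ T → P? T ×-dec (∣ T ∣ <? ∣ S ∣))
  ... | yes (T , PT , T<S) = descend T PT (rec T<S)
  ... | no  none           =
    ∣ S ∣ , (S , PS , refl) , λ T PT → ≮⇒≥ λ T<S → none (T , PT , T<S)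

module _ {n} (G : Graph n) where

  Dominates : Rel (Fin n) 0ℓ
  Dominates u v = u ≡ v ⊎ Adj G u v

  dominates? : Decidable₂ Dominates
  dominates? u v = (u ≟ᶠ v) ⊎-dec adj? G u v

  dominators : Fin n → Subset n
  dominators v = tabulate λ u → does (dominates? u v)

  ThreeDominating : Pred (Subset n) 0ℓ
  ThreeDominating S = ∀ v → v ∉ S → 3 ≤ ∣ S ∩ dominators v ∣

  threeDominating? : Decidable ThreeDominating
  threeDominating? S = all? λ v → ¬? (v ∈? S) →-dec (3 ≤? ∣ S ∩ dominators v ∣)

  minThreeDominating : ∃ (IsMinCard ThreeDominating)
  minThreeDominating = minCard threeDominating? (⊤ , λ v v∉⊤ → contradiction ∈⊤ v∉⊤)

  γ₃ : ℕ
  γ₃ = proj₁ minThreeDominating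

allButOne : ∀ n → .{{NonZero n}} → Subset n
allButOne (suc n) = outside ∷ ⊤

∣∁allButOne∣≡1 : ∀ n → .{{_ : NonZero n}} → ∣ ∁ (allButOne n) ∣ ≡ 1
∣∁allButOne∣≡1 (suc n) =
  cong suc (trans (∣∁p∣≡n∸∣p∣ (⊤ {n})) (trans (cong (n ∸_) (∣⊤∣≡n n)) (n∸n≡0 n)))

module _ {n} (G : Graph n) where

  Separating : Pred (Subset n) 0ℓ
  Separating X = Disconnected (G ─ X) ⊎ Trivial (G ─ X)

  separating? : Decidable Separating
  separating? X = ¬? (connected? (G ─ X)) ⊎-dec (∣ ∁ X ∣ ≟ 1)

  minSeparating : .{{NonZero n}} → ∃ (IsMinCard Separating)
  minSeparating = minCard separating? (allButOne n , inj₂ (∣∁allButOne∣≡1 n))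

  -- Not defined for the graph without vertices: there no set is separating.
  κ : .{{NonZero n}} → ℕ
  κ = proj₁ minSeparating

{-# OPTIONS --safe #-}

-- If u is distinct from and not adjacent to y₁, …, yⱼ, then removing N(u)
-- isolates u, so κ ≤ n − 1 − j; and γ₃ < n as soon as some vertex has three
-- neighbours.  Hence if x ≠ y are not adjacent, the sum 2n − 2 forces γ₃ = n
-- and κ = n − 2: every vertex has at most two neighbours and at most one
-- non-neighbour.  All other vertices are then adjacent to both x and y, there
-- are one or two of them, and if two, they are not adjacent to each other.
-- This gives K₁,₂ and C₄.  A complete graph has γ₃ ≤ 3 once n ≥ 3, so n ≤ 4.
-- As γ₃ and κ are isomorphism invariants, the remaining values on concrete
-- graphs are computed by evaluation.

module Submission where

open import Defs
open import Data.Empty using (⊥-elim)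
open import Data.Fin.Base using (Fin; Fin′; zero; suc; inject; fromℕ<) renaming (_<_ to _<ᶠ_)
open import Data.Fin.Permutation using (↔⇒≡)
open import Data.Fin.Properties using (any?; injective⇒≤; <-cmp; suc-injective;
  toℕ-injective; toℕ-inject; toℕ-fromℕ<) renaming (_≟_ to _≟ᶠ_)
open import Data.Fin.Subset using (Subset; inside; outside; ⊤; ⊥; ∁; ⁅_⁆; _∩_; _∈_; ∣_∣)
open import Data.Fin.Subset.Properties using (_∈?_; ∈⊤; ∣⊤∣≡n; ∣⊥∣≡0; ∣∁p∣≡n∸∣p∣; ∣p∣≤n; ∣⁅x⁆∣≡1;
  x∈⁅y⁆⇒x≡y; x∈p∩q⁺; x∈p∩q⁻; x∈∁p⇒x∉p; x∉p⇒x∈∁p; x∉∁p⇒x∈p)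
open import Data.Nat.Base using (ℕ; suc; _+_; _*_; _∸_; _≤_; _<_; NonZero; s≤s; z≤n)
open import Data.Nat.Properties using (_≟_; _<?_; _≤?_; ≤-reflexive; ≤-trans; ≤-antisym; ≮⇒≥; <-irrefl;
  <⇒≢; 1+n≰n; +-cancelʳ-≤; +-mono-≤; +-monoˡ-≤; +-suc; +-assoc; +-identityʳ; m+[n∸m]≡n; m∸n+n≡m;
  m≤m+n; module ≤-Reasoning)
open import Data.Product.Base using (∃-syntax; _×_; _,_; proj₁; proj₂)
open import Data.Sum.Base using (_⊎_; inj₁; inj₂; swap; [_,_]′)
open import Data.Vec.Base using (Vec; []; _∷_; here; there; lookup; tabulate)
open import Data.Vec.Membership.Propositional using () renaming (_∈_ to _∈ᵛ_)
open import Data.Vec.Properties using (lookup∘tabulate; []=⇒lookup; lookup⇒[]=)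
open import Data.Vec.Relation.Unary.All as All using (All; []; _∷_)
open import Data.Vec.Relation.Unary.All.Properties using (lookup⁺)
open import Data.Vec.Relation.Unary.AllPairs using ([]; _∷_)
open import Data.Vec.Relation.Unary.Any using (index)
open import Data.Vec.Relation.Unary.Any.Properties using (lookup-index)
open import Data.Vec.Relation.Unary.Unique.Propositional using (Unique)
open import Data.Vec.Relation.Unary.Unique.Propositional.Properties using (lookup-injective)
open import Function.Base using (_∘_; id)
open import Function.Bundles using (_⇔_; mk⇔; mk↔ₛ′; Equivalence; Inverse)
open import Function.Definitions using (Injective)
open import Level using (0ℓ)
open import Relation.Binary.Construct.Closure.ReflexiveTransitive using (Star; ε; _◅_; gmap)
open import Relation.Binary.Definitions using (tri<; tri≈; tri>)
open import Relation.Binary.PropositionalEquality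
  using (_≡_; _≢_; refl; sym; trans; cong; cong₂; subst; subst₂; ≢-sym)
open import Relation.Nullary using (¬_; Dec; does; yes; no; contradiction; Reflects; ofʸ; ofⁿ)
open import Relation.Nullary.Decidable using (¬?; _×-dec_; toSum; dec-true; decidable-stable)
open import Relation.Unary using (Pred; Decidable)

-- Subsets of Fin n

module _ {n} {P : Pred (Fin n) 0ℓ} (P? : Decidable P) where

  comprehension : Subset n
  comprehension = tabulate (does ∘ P?)

  ∈-comprehension⁺ : ∀ {x} → P x → x ∈ comprehension
  ∈-comprehension⁺ {x} Px =
    lookup⇒[]= x _ (trans (lookup∘tabulate (does ∘ P?) x) (dec-true (P? x) Px))

  ∈-comprehension⁻ : ∀ {x} → x ∈ comprehension → P x
  ∈-comprehension⁻ {x} x∈ with P? x | trans (sym (lookup∘tabulate (does ∘ P?) x)) ([]=⇒lookup x∈)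
  ... | yes Px | _ = Px

enum-∈ : ∀ {n} (U : Subset n) i → enum U i ∈ U
enum-∈ (inside  ∷ U) zero    = here
enum-∈ (inside  ∷ U) (suc i) = there (enum-∈ U i)
enum-∈ (outside ∷ U) i       = there (enum-∈ U i)

enum-injective : ∀ {n} (U : Subset n) → Injective _≡_ _≡_ (enum U)
enum-injective (inside  ∷ U) {zero}  {zero}  _  = refl
enum-injective (inside  ∷ U) {suc i} {suc j} eq = cong suc (enum-injective U (suc-injective eq))
enum-injective (outside ∷ U)                 eq = enum-injective U (suc-injective eq)

enum-surjective : ∀ {n} {U : Subset n} {x} → x ∈ U → ∃[ i ] enum U i ≡ x
enum-surjective {U = inside  ∷ U} here       = zero , refl
enum-surjective {U = inside  ∷ U} (there x∈) =
  let i , eq = enum-surjective x∈ in suc i , cong suc eq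
enum-surjective {U = outside ∷ U} (there x∈) =
  let i , eq = enum-surjective x∈ in i , cong suc eq

module _ {m n} {U : Subset m} {V : Subset n} {f : Fin m → Fin n} (f-maps : ∀ {x} → x ∈ U → f x ∈ V) where

  -- Vertices of an induced subgraph are positions in `enum`, so a map of vertices has to be carried
  -- over to positions before it can act on `G ─ X`.
  restrict : Fin ∣ U ∣ → Fin ∣ V ∣
  restrict i = proj₁ (enum-surjective (f-maps (enum-∈ U i)))

  enum-restrict : ∀ i → enum V (restrict i) ≡ f (enum U i)
  enum-restrict i = proj₂ (enum-surjective (f-maps (enum-∈ U i)))

  ∣∣-mono-injective : Injective _≡_ _≡_ f → ∣ U ∣ ≤ ∣ V ∣
  ∣∣-mono-injective f-inj = injective⇒≤ {f = restrict} λ {i} {j} eq →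
    enum-injective U (f-inj (trans (sym (enum-restrict i)) (trans (cong (enum V) eq) (enum-restrict j))))

unique⇒≤∣∣ : ∀ {k n} {U : Subset n} {xs : Vec (Fin n) k} → Unique xs → All (_∈ U) xs → k ≤ ∣ U ∣
unique⇒≤∣∣ {k} {U = U} {xs} uniq xs∈U =
  -- `lookup xs` is viewed as an injection from the full subset of `Fin k` into `U`.
  subst (_≤ ∣ U ∣) (∣⊤∣≡n k) (∣∣-mono-injective {U = ⊤} {f = lookup xs} (λ {i} _ → lookup⁺ xs∈U i)
    (lookup-injective uniq _ _))

∣p∣+∣∁p∣≡n : ∀ {n} (p : Subset n) → ∣ p ∣ + ∣ ∁ p ∣ ≡ n
∣p∣+∣∁p∣≡n p = trans (cong (∣ p ∣ +_) (∣∁p∣≡n∸∣p∣ p)) (m+[n∸m]≡n (∣p∣≤n p))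

-- Vectors of distinct vertices

unique⇒≤ : ∀ {k n} {xs : Vec (Fin n) k} → Unique xs → k ≤ n
unique⇒≤ uniq = injective⇒≤ (lookup-injective uniq _ _)

fresh-or-member : ∀ {k n} v (xs : Vec (Fin n) k) → All (v ≢_) xs ⊎ v ∈ᵛ xs
fresh-or-member v = All.decide λ w → swap (toSum (v ≟ᶠ w))

-- A vertex missing from `xs` could be put in front of it, giving `suc k` distinct elements of
-- `Fin n`.
exhaustive : ∀ {k n} {xs : Vec (Fin n) k} → n ≤ k → Unique xs → ∀ v → v ∈ᵛ xs
exhaustive {xs = xs} n≤k uniq v with fresh-or-member v xs
... | inj₁ v∉ = contradiction (≤-trans (unique⇒≤ (v∉ ∷ uniq)) n≤k) 1+n≰n
... | inj₂ v∈ = v∈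

-- Otherwise every vertex has a position in `xs`, and choosing one for each injects `Fin n` into the
-- smaller `Fin k`.
fresh : ∀ {k n} → k < n → (xs : Vec (Fin n) k) → ∃[ v ] All (v ≢_) xs
fresh {k} {n} k<n xs with any? (λ v → All.all? (λ w → ¬? (v ≟ᶠ w)) xs)
... | yes v,v∉ = v,v∉
... | no  none = contradiction (≤-trans k<n (injective⇒≤ position-injective)) 1+n≰n
  where
  member : ∀ v → v ∈ᵛ xs
  member v = [ (λ v∉ → contradiction (v , v∉) none) , id ]′ (fresh-or-member v xs)

  position-injective : Injective _≡_ _≡_ (index ∘ member)
  position-injective {u} {v} eq =
    trans (lookup-index (member u)) (trans (cong (lookup xs) eq) (sym (lookup-index (member v))))

-- Isomorphisms

≅-sym : ∀ {m n} {G : Graph m} {H : Graph n} → G ≅ H → H ≅ G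
≅-sym {H = H} φ = record
  { bijection = mk↔ₛ′ from to strictlyInverseʳ strictlyInverseˡ
  ; adjacency = λ u v → mk⇔
      (λ e → Equivalence.from (adjacency (from u) (from v))
               (subst₂ (Adj H) (sym (strictlyInverseˡ u)) (sym (strictlyInverseˡ v)) e))
      (λ e → subst₂ (Adj H) (strictlyInverseˡ u) (strictlyInverseˡ v)
               (Equivalence.to (adjacency (from u) (from v)) e))
  }
  where
  open _≅_ φ
  open Inverse bijection

-- By symmetry and irreflexivity it is enough to compare adjacency below the diagonal. For a
-- concrete `H` the boolean evaluates, so each pair asks for exactly one proof, of an edge or of a
-- non-edge.
≅-enumeration : ∀ {k n} {G : Graph n} {H : Graph k} {xs : Vec (Fin n) k} → n ≤ k → Unique xs →
  (∀ i (j : Fin′ i) → Reflects (Adj G (lookup xs i) (lookup xs (inject j))) (does (adj? H i (inject j)))) →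
  G ≅ H
≅-enumeration {G = G} {H} {xs} n≤k uniq reflects = ≅-sym record
  { bijection = mk↔ₛ′ (lookup xs) (index ∘ position)
      (sym ∘ lookup-index ∘ position)
      (λ i → lookup-injective uniq _ _ (sym (lookup-index (position (lookup xs i)))))
  ; adjacency = adjacency
  }
  where
  position : ∀ v → v ∈ᵛ xs
  position = exhaustive n≤k uniq

  reflects⇒⇔ : ∀ {A B : Set} (B? : Dec B) → Reflects A (does B?) → B ⇔ A
  reflects⇒⇔ (yes b) (ofʸ a)  = mk⇔ (λ _ → a) (λ _ → b)
  reflects⇒⇔ (no ¬b) (ofⁿ ¬a) = mk⇔ (⊥-elim ∘ ¬b) (⊥-elim ∘ ¬a)

  descending : ∀ {i j} → j <ᶠ i → Adj H i j ⇔ Adj G (lookup xs i) (lookup xs j)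
  descending {i} {j} j<i =
    subst (λ k → Adj H i k ⇔ Adj G (lookup xs i) (lookup xs k))
      (toℕ-injective (trans (toℕ-inject (fromℕ< j<i)) (toℕ-fromℕ< j<i)))
      (reflects⇒⇔ (adj? H i (inject (fromℕ< j<i))) (reflects i (fromℕ< j<i)))

  adjacency : ∀ i j → Adj H i j ⇔ Adj G (lookup xs i) (lookup xs j)
  adjacency i j with <-cmp i j
  ... | tri< i<j _ _  = mk⇔ (symm G ∘ to ∘ symm H) (symm H ∘ from ∘ symm G)
    where open Equivalence (descending i<j)
  ... | tri≈ _ refl _ = mk⇔ (⊥-elim ∘ irrefl H refl) (⊥-elim ∘ irrefl G refl)
  ... | tri> _ _ j<i  = descending j<i

complete⇒≅K : ∀ {n} {G : Graph n} → (∀ u v → u ≢ v → Adj G u v) → G ≅ K n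
complete⇒≅K {G = G} complete = record
  { bijection = mk↔ₛ′ id id (λ _ → refl) (λ _ → refl)
  ; adjacency = λ u v → mk⇔ (λ e u≡v → irrefl G u≡v e) (complete u v)
  }

-- Invariance of γ₃ and κ

γ₃-attained : ∀ {n} (G : Graph n) → ∃[ S ] ThreeDominating G S × ∣ S ∣ ≡ γ₃ G
γ₃-attained G = proj₁ (proj₂ (minThreeDominating G))

γ₃-least : ∀ {n} (G : Graph n) {S} → ThreeDominating G S → γ₃ G ≤ ∣ S ∣
γ₃-least G = proj₂ (proj₂ (minThreeDominating G)) _

module _ {n} .{{_ : NonZero n}} (G : Graph n) where

  κ-attained : ∃[ X ] Separating G X × ∣ X ∣ ≡ κ G
  κ-attained = proj₁ (proj₂ (minSeparating G))

  κ-least : ∀ {X} → Separating G X → κ G ≤ ∣ X ∣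
  κ-least = proj₂ (proj₂ (minSeparating G)) _

module Image {m n} {G : Graph m} {H : Graph n} (φ : G ≅ H) where

  open _≅_ φ
  open Inverse bijection

  from-injective : Injective _≡_ _≡_ from
  from-injective {u} {v} eq =
    trans (sym (strictlyInverseˡ u)) (trans (cong to eq) (strictlyInverseˡ v))

  to-injective : Injective _≡_ _≡_ to
  to-injective {u} {v} eq =
    trans (sym (strictlyInverseʳ u)) (trans (cong from eq) (strictlyInverseʳ v))

  from-adj : ∀ {u v} → Adj H u v → Adj G (from u) (from v)
  from-adj {u} {v} = Equivalence.to (_≅_.adjacency (≅-sym φ) u v)

  -- Taken as a preimage under `from`, so that membership is decided by membership in `S`.
  image : Subset m → Subset n
  image S = comprehension (λ v → from v ∈? S)

  module _ {S : Subset m} where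

    from-∈ : ∀ {v} → v ∈ image S → from v ∈ S
    from-∈ = ∈-comprehension⁻ (λ v → from v ∈? S)

    ∈-image : ∀ {v} → from v ∈ S → v ∈ image S
    ∈-image = ∈-comprehension⁺ (λ v → from v ∈? S)

    to-∈ : ∀ {u} → u ∈ S → to u ∈ image S
    to-∈ {u} u∈ = ∈-image (subst (_∈ S) (sym (strictlyInverseʳ u)) u∈)

    to-∁ : ∀ {u} → u ∈ ∁ S → to u ∈ ∁ (image S)
    to-∁ {u} u∈ = x∉p⇒x∈∁p λ to-u∈ → x∈∁p⇒x∉p u∈ (subst (_∈ S) (strictlyInverseʳ u) (from-∈ to-u∈))

    from-∁ : ∀ {v} → v ∈ ∁ (image S) → from v ∈ ∁ S
    from-∁ v∈ = x∉p⇒x∈∁p λ from-v∈ → x∈∁p⇒x∉p v∈ (∈-image from-v∈)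

    ∣image∣≤ : ∣ image S ∣ ≤ ∣ S ∣
    ∣image∣≤ = ∣∣-mono-injective {f = from} from-∈ from-injective

    threeDominating-image : ThreeDominating G S → ThreeDominating H (image S)
    threeDominating-image dom v v∉ =
      ≤-trans (dom (from v) (v∉ ∘ ∈-image)) (∣∣-mono-injective {f = to} move to-injective)
      where
      dominated : ∀ {u} → Dominates G u (from v) → Dominates H (to u) v
      dominated (inj₁ refl) = inj₁ (strictlyInverseˡ v)
      dominated (inj₂ e)    = inj₂ (subst (Adj H _) (strictlyInverseˡ v) (Equivalence.to (adjacency _ _) e))

      move : ∀ {u} → u ∈ S ∩ dominators G (from v) → to u ∈ image S ∩ dominators H v
      move u∈ = let u∈S , u∈dom = x∈p∩q⁻ S _ u∈ in
        x∈p∩q⁺ (to-∈ u∈S , ∈-comprehension⁺ (λ u → dominates? H u v)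
          (dominated (∈-comprehension⁻ (λ u → dominates? G u (from v)) u∈dom)))

    -- Disconnectedness is a negation, so it moves from `G` to `H` by pulling walks back along
    -- `from`.
    connected-image⁻ : Connected (H ─ image S) → Connected (G ─ S)
    connected-image⁻ conn i j = subst₂ (Star (Adj (G ─ S))) (back-there i) (back-there j)
      (gmap back
        (λ {a} {b} e →
          subst₂ (Adj G) (sym (enum-restrict from-∁ a)) (sym (enum-restrict from-∁ b)) (from-adj e))
        (conn (restrict to-∁ i) (restrict to-∁ j)))
      where
      back : Fin ∣ ∁ (image S) ∣ → Fin ∣ ∁ S ∣
      back = restrict from-∁

      back-there : ∀ i → back (restrict to-∁ i) ≡ i
      back-there i = enum-injective (∁ S)
        (trans (enum-restrict from-∁ (restrict to-∁ i))
          (trans (cong from (enum-restrict to-∁ i)) (strictlyInverseʳ _)))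

    separating-image : Separating G S → Separating H (image S)
    separating-image (inj₁ disc)    = inj₁ (disc ∘ connected-image⁻)
    separating-image (inj₂ trivial) = inj₂ (trans
      (≤-antisym (∣∣-mono-injective {f = from} from-∁ from-injective)
                 (∣∣-mono-injective {f = to} to-∁ to-injective)) trivial)

  -- The image of a minimum three dominating set competes in the minimum for `H`. The reverse
  -- inequality comes from `≅-sym`.
  γ₃-≤ : γ₃ H ≤ γ₃ G
  γ₃-≤ = let S , dom , ∣S∣≡γ = γ₃-attained G in
    ≤-trans (γ₃-least H (threeDominating-image dom)) (≤-trans ∣image∣≤ (≤-reflexive ∣S∣≡γ))

  κ-≤ : .{{_ : NonZero m}} .{{_ : NonZero n}} → κ H ≤ κ G
  κ-≤ = let X , sep , ∣X∣≡κ = κ-attained G in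
    ≤-trans (κ-least H (separating-image sep)) (≤-trans ∣image∣≤ (≤-reflexive ∣X∣≡κ))

γ₃-cong : ∀ {m n} {G : Graph m} {H : Graph n} → G ≅ H → γ₃ G ≡ γ₃ H
γ₃-cong φ = ≤-antisym (Image.γ₃-≤ (≅-sym φ)) (Image.γ₃-≤ φ)

κ-cong : ∀ {m n} .{{_ : NonZero m}} .{{_ : NonZero n}} {G : Graph m} {H : Graph n} → G ≅ H → κ G ≡ κ H
κ-cong φ = ≤-antisym (Image.κ-≤ (≅-sym φ)) (Image.κ-≤ φ)

-- Bounds on γ₃ and κ

γ₃≤n : ∀ {n} (G : Graph n) → γ₃ G ≤ n
γ₃≤n {n} G = subst (γ₃ G ≤_) (∣⊤∣≡n n) (γ₃-least G λ v v∉⊤ → contradiction ∈⊤ v∉⊤)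

-- All vertices but `v` form a three dominating set, since `v` is the only vertex to check.
γ₃<n : ∀ {n} (G : Graph n) v {xs : Vec (Fin n) 3} → Unique xs → All (Adj G v) xs → γ₃ G < n
γ₃<n {n} G v {xs} uniq nbrs =
  subst (suc (γ₃ G) ≤_) (trans (cong (_+ ∣ ∁ ⁅ v ⁆ ∣) (sym (∣⁅x⁆∣≡1 v))) (∣p∣+∣∁p∣≡n ⁅ v ⁆))
    (s≤s (γ₃-least G dom))
  where
  dom : ThreeDominating G (∁ ⁅ v ⁆)
  dom w w∉ with x∈⁅y⁆⇒x≡y v (x∉∁p⇒x∈p w∉)
  ... | refl = unique⇒≤∣∣ uniq (All.map (λ {u} e → x∈p∩q⁺
    ( x∉p⇒x∈∁p (λ u∈ → irrefl G (sym (x∈⁅y⁆⇒x≡y v u∈)) e)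
    , ∈-comprehension⁺ (λ u → dominates? G u v) (inj₂ (symm G e)))) nbrs)

-- Any three vertices will do, here the first three: a vertex outside differs from each of them and
-- so is adjacent to each.
γ₃-K≤3 : ∀ {n} → 3 ≤ n → γ₃ (K n) ≤ 3
γ₃-K≤3 {suc (suc (suc m))} (s≤s (s≤s (s≤s z≤n))) =
  subst (γ₃ (K (suc (suc (suc m)))) ≤_) (cong (3 +_) (∣⊥∣≡0 m)) (γ₃-least (K (suc (suc (suc m)))) dom)
  where
  S : Subset (suc (suc (suc m)))
  S = inside ∷ inside ∷ inside ∷ ⊥

  dom : ThreeDominating (K (suc (suc (suc m)))) S
  dom v v∉ = unique⇒≤∣∣ {xs = zero ∷ suc zero ∷ suc (suc zero) ∷ []}
    (((λ ()) ∷ (λ ()) ∷ []) ∷ ((λ ()) ∷ []) ∷ [] ∷ [])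
    (dominator here ∷ dominator (there here) ∷ dominator (there (there here)) ∷ [])
    where
    dominator : ∀ {u} → u ∈ S → u ∈ S ∩ dominators (K _) v
    dominator u∈ = x∈p∩q⁺ (u∈ , ∈-comprehension⁺ (λ u → dominates? (K _) u v)
      (inj₂ λ { refl → v∉ u∈ }))

-- Deleting the neighbourhood of `v` leaves `v` alone or isolated, and `xs` lies in what is left.
-- Not being adjacent to itself, `v` may be listed in `xs` and then counts towards `k`.
κ+nonNeighbours≤n : ∀ {n k} .{{_ : NonZero n}} (G : Graph n) v {xs : Vec (Fin n) k} →
  Unique xs → All (λ x → ¬ Adj G v x) xs → κ G + k ≤ n
κ+nonNeighbours≤n {n} {k} G v {xs} uniq non =
  ≤-trans (+-mono-≤ (κ-least G separating)
                    (unique⇒≤∣∣ uniq (All.map (λ ¬e → x∉p⇒x∈∁p (¬e ∘ ∈-comprehension⁻ (adj? G v))) non)))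
          (≤-reflexive (∣p∣+∣∁p∣≡n X))
  where
  X : Subset n
  X = comprehension (adj? G v)

  constant⇒≡1 : ∀ {m} (i : Fin m) → (∀ j → i ≡ j) → m ≡ 1
  constant⇒≡1 {1}           i const = refl
  constant⇒≡1 {suc (suc m)} i const = contradiction (trans (sym (const zero)) (const (suc zero))) λ ()

  v′ : ∃[ i ] enum (∁ X) i ≡ v
  v′ = enum-surjective (x∉p⇒x∈∁p (irrefl G refl ∘ ∈-comprehension⁻ (adj? G v)))

  isolated : ∀ {j} → Star (Adj (G ─ X)) (proj₁ v′) j → proj₁ v′ ≡ j
  isolated ε = refl
  isolated (_◅_ {j = b} e _) = contradiction
    (∈-comprehension⁺ (adj? G v) (subst (λ u → Adj G u (enum (∁ X) b)) (proj₂ v′) e))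
    (x∈∁p⇒x∉p (enum-∈ (∁ X) b))

  separating : Separating G X
  separating with ∣ ∁ X ∣ ≟ 1
  ... | yes trivial = inj₂ trivial
  -- If the rest were connected, each of its vertices would equal the isolated one.
  ... | no ¬trivial = inj₁ λ conn → ¬trivial (constant⇒≡1 (proj₁ v′) λ j → isolated (conn _ j))

-- Extremal graphs

-- The truncated subtraction is exact because `n` is nonzero.
2n∸2+2≡n+n : ∀ n .{{_ : NonZero n}} → 2 * n ∸ 2 + 2 ≡ n + n
2n∸2+2≡n+n n@(suc _) = trans
  (m∸n+n≡m {2 * n} {2} (+-mono-≤ {1} {n} {1} (s≤s z≤n) (s≤s z≤n)))
  (cong (n +_) (+-identityʳ n))

module _ {n} .{{_ : NonZero n}} (G : Graph n) (extremal : γ₃ G + κ G ≡ 2 * n ∸ 2) where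

  -- In this form the bounds `γ₃ G ≤ n` and `κ G + 2 ≤ n` can be added summand by summand, and
  -- strictness in either one is contradictory.
  sum+2≡n+n : γ₃ G + (κ G + 2) ≡ n + n
  sum+2≡n+n = trans (sym (+-assoc (γ₃ G) (κ G) 2)) (trans (cong (_+ 2) extremal) (2n∸2+2≡n+n n))

  -- Extremal graphs with two non-adjacent vertices

  module NonComplete (conn : Connected G) {x y} (x≢y : x ≢ y) (¬xy : ¬ Adj G x y) where

    noThreeNeighbours : ∀ v {xs : Vec (Fin n) 3} → Unique xs → ¬ All (Adj G v) xs
    noThreeNeighbours v uniq nbrs = <-irrefl sum+2≡n+n
      -- The bound on `κ` uses `x` with the non-neighbours `x` and `y`, whatever `v` is.
      (+-mono-≤ (γ₃<n G v uniq nbrs)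
        (κ+nonNeighbours≤n G x ((x≢y ∷ []) ∷ [] ∷ []) (irrefl G refl ∷ ¬xy ∷ [])))

    uniqueNonNeighbour : ∀ {u v w} → Unique (u ∷ v ∷ w ∷ []) → ¬ Adj G u v → Adj G u w
    uniqueNonNeighbour {u} {v} {w} uniq ¬uv = decidable-stable (adj? G u w) λ ¬uw → <-irrefl sum+2≡n+n
      (subst (_≤ n + n) (trans (cong (γ₃ G +_) (+-suc (κ G) 2)) (+-suc (γ₃ G) (κ G + 2)))
        (+-mono-≤ (γ₃≤n G) (κ+nonNeighbours≤n G u uniq (irrefl G refl ∷ ¬uv ∷ ¬uw ∷ []))))

    adj-x : ∀ {w} → w ≢ x → w ≢ y → Adj G x w
    adj-x w≢x w≢y = uniqueNonNeighbour
      ((x≢y ∷ ≢-sym w≢x ∷ []) ∷ (≢-sym w≢y ∷ []) ∷ [] ∷ []) ¬xy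

    adj-y : ∀ {w} → w ≢ x → w ≢ y → Adj G y w
    adj-y w≢x w≢y = uniqueNonNeighbour
      ((≢-sym x≢y ∷ ≢-sym w≢y ∷ []) ∷ (≢-sym w≢x ∷ []) ∷ [] ∷ []) (¬xy ∘ symm G)

    neighbour : ∃[ z ] z ≢ x × z ≢ y
    neighbour with conn x y
    ... | ε                 = contradiction refl x≢y
    -- The first step of a walk from `x` to `y` can end neither in `x` nor in `y`.
    ... | _◅_ {j = z} xz _  = z , (λ { refl → irrefl G refl xz }) , (λ { refl → ¬xy xz })

    classify : G ≅ C 4 (s≤s (s≤s (s≤s z≤n))) ⊎ G ≅ K[ 1 , 2 ]
    classify with neighbour
    ... | z , z≢x , z≢y with 3 <? n
    -- The centre `z` comes first because the part of size one is vertex 0.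
    ...   | no  3≮n = inj₂ (≅-enumeration {xs = z ∷ x ∷ y ∷ []} (≮⇒≥ 3≮n)
      ((z≢x ∷ z≢y ∷ []) ∷ (x≢y ∷ []) ∷ [] ∷ []) λ
      { (suc zero)       zero       → ofʸ (adj-x z≢x z≢y)
      ; (suc (suc zero)) zero       → ofʸ (adj-y z≢x z≢y)
      ; (suc (suc zero)) (suc zero) → ofⁿ (¬xy ∘ symm G)
      })
    ...   | yes 3<n with fresh 3<n (x ∷ y ∷ z ∷ [])
    ...     | w , w≢x ∷ w≢y ∷ w≢z ∷ [] with 4 <? n
    -- The listing follows the 4-cycle, with the non-adjacent pairs `x`, `y` and `z`, `w` opposite
    -- each other.
    ...       | no  4≮n = inj₁ (≅-enumeration {xs = x ∷ z ∷ y ∷ w ∷ []} (≮⇒≥ 4≮n)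
      ((≢-sym z≢x ∷ x≢y ∷ ≢-sym w≢x ∷ []) ∷ (z≢y ∷ ≢-sym w≢z ∷ []) ∷ (≢-sym w≢y ∷ []) ∷ [] ∷ []) λ
      { (suc zero)             zero             → ofʸ (symm G (adj-x z≢x z≢y))
      ; (suc (suc zero))       zero             → ofⁿ (¬xy ∘ symm G)
      ; (suc (suc zero))       (suc zero)       → ofʸ (adj-y z≢x z≢y)
      ; (suc (suc (suc zero))) zero             → ofʸ (symm G (adj-x w≢x w≢y))
      ; (suc (suc (suc zero))) (suc zero)       → ofⁿ λ wz →
          noThreeNeighbours z ((x≢y ∷ ≢-sym w≢x ∷ []) ∷ (≢-sym w≢y ∷ []) ∷ [] ∷ [])
            (symm G (adj-x z≢x z≢y) ∷ symm G (adj-y z≢x z≢y) ∷ symm G wz ∷ [])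
      ; (suc (suc (suc zero))) (suc (suc zero)) → ofʸ (symm G (adj-y w≢x w≢y))
      })
    ...       | yes 4<n with fresh 4<n (x ∷ y ∷ z ∷ w ∷ [])
    -- A fifth vertex would give `x` the three neighbours `z`, `w` and `v`.
    ...         | v , v≢x ∷ v≢y ∷ v≢z ∷ v≢w ∷ [] = contradiction
      (adj-x z≢x z≢y ∷ adj-x w≢x w≢y ∷ adj-x v≢x v≢y ∷ [])
      (noThreeNeighbours x ((≢-sym w≢z ∷ ≢-sym v≢z ∷ []) ∷ (≢-sym v≢w ∷ []) ∷ [] ∷ []))

-- Complete graphs and the equivalence

γ₃+κ-cong : ∀ {m n} .{{_ : NonZero m}} .{{_ : NonZero n}} {G : Graph m} {H : Graph n} → G ≅ H →
  γ₃ G + κ G ≡ γ₃ H + κ H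
γ₃+κ-cong φ = cong₂ _+_ (γ₃-cong φ) (κ-cong φ)

-- Since `κ G ≤ n ∸ 1`, the sum is at most `n + 2`, which is below `2 * n ∸ 2` from `n = 5` on.
γ₃+κ<2n∸2 : ∀ {n} .{{_ : NonZero n}} (G : Graph n) → 5 ≤ n → γ₃ G ≤ 3 → γ₃ G + κ G < 2 * n ∸ 2
γ₃+κ<2n∸2 {n} G 5≤n γ₃≤3 = +-cancelʳ-≤ 2 _ _ (begin
  suc (γ₃ G + κ G) + 2       ≡⟨ cong suc (trans (+-assoc (γ₃ G) (κ G) 2) (cong (γ₃ G +_) (+-suc (κ G) 1))) ⟩
  suc (γ₃ G) + suc (κ G + 1) ≤⟨ +-mono-≤ (s≤s γ₃≤3) (s≤s κ+1≤n) ⟩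
  4 + suc n                  ≡⟨ +-suc 4 n ⟩
  5 + n                      ≤⟨ +-monoˡ-≤ n 5≤n ⟩
  n + n                      ≡⟨ sym (2n∸2+2≡n+n n) ⟩
  2 * n ∸ 2 + 2              ∎)
  where
  open ≤-Reasoning

  κ+1≤n : κ G + 1 ≤ n
  -- Vertex 0 serves as its own single non-neighbour.
  κ+1≤n = κ+nonNeighbours≤n G (fromℕ< (≤-trans (s≤s z≤n) 5≤n)) ([] ∷ []) (irrefl G refl ∷ [])

completeExtremal⇒n≡4 : ∀ n .{{_ : NonZero n}} → γ₃ (K n) + κ (K n) ≡ 2 * n ∸ 2 → n ≡ 4
completeExtremal⇒n≡4 n extremal with 5 ≤? n
... | yes 5≤n = contradiction extremal
  (<⇒≢ (γ₃+κ<2n∸2 (K n) 5≤n (γ₃-K≤3 (≤-trans (m≤m+n 3 2) 5≤n))))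
-- For `n` up to 3 both sides evaluate to numerals, and the sum exceeds `2 * n ∸ 2` by one.
completeExtremal⇒n≡4 1 1≡0 | no _ = contradiction 1≡0 λ ()
completeExtremal⇒n≡4 2 3≡2 | no _ = contradiction 3≡2 λ ()
completeExtremal⇒n≡4 3 5≡4 | no _ = contradiction 5≡4 λ ()
completeExtremal⇒n≡4 4 _   | no _ = refl
completeExtremal⇒n≡4 (suc (suc (suc (suc (suc m))))) _ | no 5≰n = contradiction (m≤m+n 5 m) 5≰n

≅⇒extremal : ∀ {m n} .{{_ : NonZero m}} .{{_ : NonZero n}} {G : Graph m} {H : Graph n} →
  γ₃ H + κ H ≡ 2 * n ∸ 2 → G ≅ H → γ₃ G + κ G ≡ 2 * m ∸ 2
≅⇒extremal extremal φ =
  trans (γ₃+κ-cong φ) (trans extremal (cong (λ k → 2 * k ∸ 2) (sym (↔⇒≡ (_≅_.bijection φ)))))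

complete? : ∀ {n} (G : Graph n) → (∀ u v → u ≢ v → Adj G u v) ⊎ (∃[ u ] ∃[ v ] u ≢ v × ¬ Adj G u v)
complete? G with any? (λ u → any? (λ v → ¬? (u ≟ᶠ v) ×-dec ¬? (adj? G u v)))
... | yes nonAdjacent = inj₂ nonAdjacent
... | no  none        = inj₁ λ u v u≢v → decidable-stable (adj? G u v) λ ¬uv → none (u , v , u≢v , ¬uv)

theorem3p2 : ∀ (n : ℕ) .{{_ : NonZero n}} (G : Graph n) → Connected G →
    (γ₃ G + κ G ≡ 2 * n ∸ 2) ⇔ (G ≅ K 4 ⊎ G ≅ C 4 (s≤s (s≤s (s≤s z≤n))) ⊎ G ≅ K[ 1 , 2 ])
-- Each `refl` evaluates `γ₃` and `κ`: 3 + 3 for `K 4`, 4 + 2 for the 4-cycle, 3 + 1 for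
-- `K[ 1 , 2 ]`.
theorem3p2 n G conn = mk⇔ forward [ ≅⇒extremal refl , [ ≅⇒extremal refl , ≅⇒extremal refl ]′ ]′
  where
  forward : γ₃ G + κ G ≡ 2 * n ∸ 2 → G ≅ K 4 ⊎ G ≅ C 4 (s≤s (s≤s (s≤s z≤n))) ⊎ G ≅ K[ 1 , 2 ]
  forward extremal with complete? G
  ... | inj₂ (_ , _ , x≢y , ¬xy) = inj₂ (NonComplete.classify G extremal conn x≢y ¬xy)
  ... | inj₁ complete            =
    inj₁ (subst (λ m → G ≅ K m) (completeExtremal⇒n≡4 n (trans (sym (γ₃+κ-cong G≅K)) extremal)) G≅K)
    where
    G≅K : G ≅ K n
    G≅K = complete⇒≅K complete
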